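{- Let $m,n\ge0$ be integers. The shadow map $\mathrm{Sh}$ is a surjective meet semilattice morphism from the binary $m$-painted $n$-tree rotation lattice to the unary $m$-lighted $n$-shade rotation lattice; that is, it is surjective and $\mathrm{Sh}(\mathbb{T}\wedge\mathbb{T}')=\mathrm{Sh}(\mathbb{T})\wedge\mathrm{Sh}(\mathbb{T}')$ for all binary $m$-painted $n$-trees $\mathbb{T},\mathbb{T}'$.
   Context: Write $[k]=\{1,\dots,k\}$. **Painted trees.** An $n$-tree is a rooted plane tree with $n+1$ leaves, drawn growing downward from its root; "node" means internal node (leaves excluded), and unary nodes are allowed. A cut of an $n$-tree $T$ is a set of nodes of $T$ containing exactly one node on the path from the root to each leaf. A cut $c$ is below a cut $c'$ if, along any path from the root to a leaf, the node of $c$ is (strictly) after the node of $c'$. An $m$-painted $n$-tree $\mathbb{T}=(T,C,\mu)$ is an $n$-tree $T$ with a sequence $C=(c_1,\dots,c_k)$ of cuts of $T$, with $c_i$ below $c_{i+1}$ for all $i\in[k-1]$, such that $\bigcup C=c_1\cup\dots\cup c_k$ contains all unary nodes of $T$, and an ordered partition $\mu=(\mu_1,\dots,\mu_k)$ of $[m]$ into $k$ nonempty parts ($1\le k\le m$, or $k=0$ if $m=0$); $\mu_i$ is the label of $c_i$. It is binary if $k=m$, all nodes in $\bigcup C$ are unary and all nodes not in $\bigcup C$ are binary (have exactly two children). **Rotation lattice on painted trees.** The right rotation digraph on binary $m$-painted $n$-trees has three types of edges: (i) right rotate an edge of $T$ joining two binary nodes (a left child $i$ of $j$ is replaced by $j$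 becoming the right child of $i$, as in the Tamari lattice); (ii) move a cut past a binary node just above it (a binary node whose two children are both nodes of the same cut $c$ is replaced by a unary node of $c$ whose child is this binary node, whose two subtrees are now the former subtrees under the two unary nodes); (iii) exchange the labels of two consecutive cuts with no node of $T$ in between them, passing the small label above the large label (before the move the larger label is above the smaller one). It is known that this digraph is the Hasse diagram of a lattice (edges go upward in the order), the binary $m$-painted $n$-tree rotation lattice. **Shades.** An $m$-lighted $n$-shade is a pair of sequences $S=(s_1,\dots,s_\ell)$ and $(c_1,\dots,c_\ell)$ of the same length $\ell\ge 0$, where each $s_i$ is a (possibly empty) tuple of positive integers, the sum of all entries is $n$, the $c_i$ are pairwise disjoint (possibly empty) subsets of $[m]$ with union $[m]$, and $c_i\neq\varnothing$ whenever $s_i$ is empty. It is read from top to bottom; an index $i$ with $c_i\neq\varnothing$ is a cut with labels $c_i$. It is unary if for each $i$, either $s_i$ is empty and $c_i$ is a singleton, or $c_i=\varnothing$ and $s_i$ has exactly one entry (a "singleton tuple"). **Rotation lattice on shades.** The right rotation digraph on unary $m$-lighted $n$-shades has an edge from $\mathbb{S}$ to $\mathbb{S}'$ whenever $\mathbb{S}'$ is obtained from $\mathbb{S}$ by: (i) replacing a singleton tuple $(r)$ by two consecutive singleton tuples $(s),(t)$ with $r=s+t$, $s,t\ge1$; (ii) exchanging a singleton tuple with a cut immediately below it (the cut moves above it); or (iii) exchanging the labels of two consecutive cuts with no singleton tuple in between, passing the small label above the large label. This digraph is the Hasse diagram of a lattice (edges go upward), the unary $m$-lighted $n$-shade rotation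 lattice. **Shadow map.** The right branch of $T$ is the path from the root to the rightmost leaf. The shadow $\mathrm{Sh}(\mathbb{T})$ of $\mathbb{T}=(T,C,\mu)$ is the $m$-lighted $n$-shade whose $i$-th tuple is $(n_1,\dots,n_{p-1})$, where $n_1,\dots,n_p$ are the numbers of leaves of the subtrees, from left to right, of the $i$-th node of the right branch (from the root downward), and whose $i$-th label set is the label of the cut of $C$ containing this node ($\varnothing$ if there is none). -}

module Defs where

open import Data.Empty using (⊥-elim)
open import Data.Fin.Base as Fin using (Fin; zero; suc; toℕ)
open import Data.Fin.Properties using (pigeonhole) renaming (_≟_ to _≟ᶠ_)
open import Data.Fin.Subset
  using (Subset; _∈_; _∩_; _∪_; ⊥; ⊤; ⁅_⁆; ⋃; Empty; Nonempty)
open import Data.Fin.Subset.Properties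
  using (∉⊥; x∈⁅x⁆; x∈⁅y⁆⇒x≡y; x∈p∩q⁺; ∩-comm; ∩-zeroˡ; ⊆-antisym
        ; ∪-assoc; ∪-comm; ∪-identityˡ)
open import Data.Irrelevant using ([_])
open import Data.List.Base using (List; []; _∷_; _++_; map; concat; catMaybes; allFin; reverse; length; tabulate)
open import Data.List.Membership.Propositional using () renaming (_∈_ to _∈ₗ_)
open import Data.List.Membership.Propositional.Properties using (∈-map⁺; ∈-++⁺ˡ; ∈-++⁺ʳ)
open import Data.List.NonEmpty.Base using (List⁺; _∷_; toList) renaming (length to length⁺)
open import Data.List.Properties using (reverse-map; map-tabulate; map-∘)
open import Data.List.Relation.Binary.Permutation.Propositional as ↭ using (_↭_; ↭-sym)
open import Data.List.Relation.Binary.Permutation.Propositional.Properties using (↭-reverse)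
open import Data.List.Relation.Unary.All as All using (All; []; _∷_)
open import Data.List.Relation.Unary.All.Properties using (map⁺)
open import Data.List.Relation.Unary.AllPairs using (AllPairs; []; _∷_)
open import Data.List.Relation.Unary.Any using (here; there)
open import Data.Maybe using (Maybe; just; nothing; maybe′; Is-just; Is-nothing)
open import Data.Maybe.Relation.Unary.All using (nothing)
open import Data.Maybe.Relation.Unary.Any using (just)
open import Data.Nat.Base using (ℕ; suc; _+_; _<_; s≤s; z≤n)
open import Data.Nat.Properties using (m≤m+n; ≤-trans; ≤-refl; +-assoc; +-comm; suc-injective; +-identityʳ; <⇒≢)
open import Data.Nat.ListAction using (sum)
open import Data.Nat.ListAction.Properties using (sum-++)
open import Data.Product.Base using (∃-syntax; _×_; _,_; proj₁; proj₂)
open import Data.Refinement using (Refinement-syntax; _,_; value)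
open import Data.Sum.Base using (_⊎_; inj₁; inj₂)
open import Data.Unit.Base using (tt)
open import Data.Vec.Base as Vec using (Vec; lookup; _[_]≔_)
open import Function.Base using (_∘_; _on_)
open import Level using (Level; 0ℓ; _⊔_)
open import Relation.Binary.Construct.Closure.ReflexiveTransitive using (Star)
open import Relation.Binary.Core using (Rel)
open import Relation.Binary.PropositionalEquality
  using (_≡_; _≢_; refl; sym; trans; cong; subst; module ≡-Reasoning)
open import Relation.Nullary using (yes; no; contradiction)

private variable
  a ℓ : Level
  A : Set a
  k m n : ℕ

------------------------------------------------------------------------
-- Rooted plane trees whose (internal) nodes are decorated by A

data Tree (A : Set a) : Set a where
  leaf : Tree A
  node : A → List⁺ (Tree A) → Tree A

leaves  : Tree A → ℕ
leavesˡ : List (Tree A) → ℕ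
leaves leaf            = 1
leaves (node _ (t ∷ ts)) = leaves t + leavesˡ ts
leavesˡ []       = 0
leavesˡ (t ∷ ts) = leaves t + leavesˡ ts

-- The paths from the root to the leaves, each given by the decorations of its
-- nodes, from the root downward.

paths  : Tree A → List (List A)
pathsˡ : List (Tree A) → List (List A)
paths leaf              = [] ∷ []
paths (node x (t ∷ ts)) = map (x ∷_) (paths t ++ pathsˡ ts)
pathsˡ []       = []
pathsˡ (t ∷ ts) = paths t ++ pathsˡ ts

-- P x p holds for every node with decoration x and p children.

data AllNodes {A : Set a} (P : A → ℕ → Set ℓ) : Tree A → Set (a ⊔ ℓ) where
  leaf : AllNodes P leaf
  node : ∀ {x ts} → P x (length⁺ ts) → All (AllNodes P) (toList ts) →
         AllNodes P (node x ts)

-- The nodes of the right branch, from the root downward, each with the numbers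
-- of leaves of its subtrees except the last one.

init-leaves : Tree A → List (Tree A) → List ℕ
init-leaves _ []       = []
init-leaves t (u ∷ us) = leaves t ∷ init-leaves u us

rightBranch  : Tree A → List (List ℕ × A)
rightBranchˡ : Tree A → List (Tree A) → List (List ℕ × A)
rightBranch leaf              = []
rightBranch (node x (t ∷ ts)) = (init-leaves t ts , x) ∷ rightBranchˡ t ts
rightBranchˡ t []       = rightBranch t
rightBranchˡ _ (u ∷ us) = rightBranchˡ u us

------------------------------------------------------------------------
-- Set partitions of [m], represented as Fin m

Disjoint : Rel (Subset m) 0ℓ
Disjoint p q = Empty (p ∩ q)

-- Possibly with empty parts.

record IsPartition (ps : List (Subset m)) : Set where
  constructor mkPartition
  field
    disjoint : AllPairs Disjoint ps
    covers   : ⋃ ps ≡ ⊤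

------------------------------------------------------------------------
-- Painted trees

-- Cuts c₁, …, cₖ with each cᵢ below cᵢ₊₁ are pairwise disjoint, so the sequence
-- (c₁, …, cₖ) is encoded by decorating each node of the tree with the index of
-- the cut containing it, if any.  The index i : Fin k stands for c_{i+1}, hence
-- larger indices are higher in the tree.

MarkedTree : ℕ → Set
MarkedTree k = Tree (Maybe (Fin k))

-- The cut condition says that every path from the root to a leaf has exactly
-- one node in each cut, and meets cₖ, …, c₁ in this order.

record IsPainted (n : ℕ) (t : MarkedTree k) (μ : Vec (Subset m) k) : Set where
  constructor mkPainted
  field
    size      : leaves t ≡ suc n
    cuts      : All (λ path → catMaybes path ≡ reverse (allFin k)) (paths t)
    unary     : AllNodes (λ c p → p ≡ 1 → Is-just c) t
    partition : IsPartition (Vec.toList μ)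
    nonempty  : ∀ i → Nonempty (lookup μ i)

-- Propositional equality of painted trees ignores the proof of validity.

record PaintedTree (m n : ℕ) : Set where
  constructor painted
  field
    {#cuts}    : ℕ
    tree       : MarkedTree #cuts
    label      : Vec (Subset m) #cuts
    .isPainted : IsPainted n tree label

record IsBinary (T : PaintedTree m n) : Set where
  constructor mkBinary
  open PaintedTree T
  field
    #cuts≡m : #cuts ≡ m
    arities : AllNodes (λ c p → (Is-just c → p ≡ 1) × (Is-nothing c → p ≡ 2)) tree

BinaryPaintedTree : ℕ → ℕ → Set
BinaryPaintedTree m n = [ T ∈ PaintedTree m n ∣ IsBinary T ]

pattern unary  c t   = node (just c) (t ∷ [])
pattern binary t₁ t₂ = node nothing (t₁ ∷ t₂ ∷ [])

infix 4 _⟶ᵗ_ _⟶ᵖ_ _⟶ᵉ_ _≤ᵖ_ _≤ˢ_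

data _⟶ᵗ_ {k : ℕ} : Rel (MarkedTree k) 0ℓ where
  rotate  : ∀ {t₁ t₂ t₃} →
            binary (binary t₁ t₂) t₃ ⟶ᵗ binary t₁ (binary t₂ t₃)
  moveCut : ∀ {c t₁ t₂} →
            binary (unary c t₁) (unary c t₂) ⟶ᵗ unary c (binary t₁ t₂)
  below   : ∀ {c t t′} → t ⟶ᵗ t′ → unary c t ⟶ᵗ unary c t′
  left    : ∀ {t t′ u} → t ⟶ᵗ t′ → binary t u ⟶ᵗ binary t′ u
  right   : ∀ {t u u′} → u ⟶ᵗ u′ → binary t u ⟶ᵗ binary t u′

-- No node lies between the cut j and the cut i just below it.

Adjacent : (j i : Fin k) → MarkedTree k → Set
Adjacent j i t = All (λ path → ∃[ xs ] ∃[ ys ] path ≡ xs ++ just j ∷ just i ∷ ys) (paths t)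

data _⟶ᵖ_ {m n : ℕ} : Rel (PaintedTree m n) 0ℓ where
  onTree   : ∀ {k} {t t′ : MarkedTree k} {μ : Vec (Subset m) k}
             .{p : IsPainted n t μ} .{p′ : IsPainted n t′ μ} →
             t ⟶ᵗ t′ → painted t μ p ⟶ᵖ painted t′ μ p′
  exchange : ∀ {k} {t : MarkedTree k} {μ : Vec (Subset m) k} {i j x y}
             .{p : IsPainted n t μ}
             .{p′ : IsPainted n t (μ [ j ]≔ ⁅ x ⁆ [ i ]≔ ⁅ y ⁆)} →
             toℕ j ≡ suc (toℕ i) → Adjacent j i t →
             lookup μ j ≡ ⁅ y ⁆ → lookup μ i ≡ ⁅ x ⁆ → x Fin.< y →
             painted t μ p ⟶ᵖ painted t (μ [ j ]≔ ⁅ x ⁆ [ i ]≔ ⁅ y ⁆) p′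

_≤ᵖ_ : Rel (BinaryPaintedTree m n) 0ℓ
_≤ᵖ_ = Star (_⟶ᵖ_ on value)

------------------------------------------------------------------------
-- Shades

-- The pairs (sᵢ , cᵢ), from top to bottom.

Entry : ℕ → Set
Entry m = List ℕ × Subset m

record IsShade (n : ℕ) (es : List (Entry m)) : Set where
  constructor mkShade
  field
    positive  : All (All (0 <_) ∘ proj₁) es
    total     : sum (concat (map proj₁ es)) ≡ n
    partition : IsPartition (map proj₂ es)
    nonempty  : All (λ (s , c) → s ≡ [] → Nonempty c) es

record Shade (m n : ℕ) : Set where
  constructor shade
  field
    entries  : List (Entry m)
    .isShade : IsShade n entries

open Shade using (entries)

IsUnary : Shade m n → Set
IsUnary S = All (λ (s , c) → (s ≡ [] × ∃[ x ] c ≡ ⁅ x ⁆) ⊎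
                             (c ≡ ⊥ × ∃[ r ] s ≡ r ∷ []))
                (entries S)

UnaryShade : ℕ → ℕ → Set
UnaryShade m n = [ S ∈ Shade m n ∣ IsUnary S ]

data _⟶ᵉ_ {m : ℕ} : Rel (List (Entry m)) 0ℓ where
  split    : ∀ {s t es} → 0 < s → 0 < t →
             (s + t ∷ [] , ⊥) ∷ es ⟶ᵉ (s ∷ [] , ⊥) ∷ (t ∷ [] , ⊥) ∷ es
  moveCut  : ∀ {r x es} →
             (r ∷ [] , ⊥) ∷ ([] , ⁅ x ⁆) ∷ es ⟶ᵉ ([] , ⁅ x ⁆) ∷ (r ∷ [] , ⊥) ∷ es
  exchange : ∀ {x y es} → x Fin.< y →
             ([] , ⁅ y ⁆) ∷ ([] , ⁅ x ⁆) ∷ es ⟶ᵉ ([] , ⁅ x ⁆) ∷ ([] , ⁅ y ⁆) ∷ es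
  below    : ∀ {e es es′} → es ⟶ᵉ es′ → e ∷ es ⟶ᵉ e ∷ es′

_≤ˢ_ : Rel (UnaryShade m n) 0ℓ
_≤ˢ_ = Star (_⟶ᵉ_ on (entries ∘ value))

------------------------------------------------------------------------
-- Meets

-- z is the greatest lower bound of x and y.

IsMeet : Rel A ℓ → A → A → A → Set _
IsMeet _≤_ x y z = z ≤ x × z ≤ y × (∀ w → w ≤ x → w ≤ y → w ≤ z)

------------------------------------------------------------------------
-- The shadow map

shadowEntry : Vec (Subset m) k → List ℕ × Maybe (Fin k) → Entry m
shadowEntry μ (s , c) = s , maybe′ (lookup μ) ⊥ c

shadowEntries : MarkedTree k → Vec (Subset m) k → List (Entry m)
shadowEntries t μ = map (shadowEntry μ) (rightBranch t)

module ShadowProperties where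

  leaves>0 : (t : Tree A) → 0 < leaves t
  leaves>0 leaf              = s≤s z≤n
  leaves>0 (node _ (t ∷ ts)) = ≤-trans (leaves>0 t) (m≤m+n _ _)

  init>0 : ∀ (t : Tree A) ts → All (0 <_) (init-leaves t ts)
  init>0 t []       = []
  init>0 t (u ∷ us) = leaves>0 t ∷ init>0 u us

  branch>0  : (t : Tree A) → All (All (0 <_) ∘ proj₁) (rightBranch t)
  branch>0ˡ : ∀ (t : Tree A) ts → All (All (0 <_) ∘ proj₁) (rightBranchˡ t ts)
  branch>0 leaf              = []
  branch>0 (node _ (t ∷ ts)) = init>0 t ts ∷ branch>0ˡ t ts
  branch>0ˡ t []       = branch>0 t
  branch>0ˡ t (u ∷ us) = branch>0ˡ u us

  total : List (List ℕ × A) → ℕ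
  total es = sum (concat (map proj₁ es))

  total-branch  : (t : Tree A) → suc (total (rightBranch t)) ≡ leaves t
  total-branchˡ : ∀ (t : Tree A) ts →
    suc (sum (init-leaves t ts) + total (rightBranchˡ t ts)) ≡ leaves t + leavesˡ ts
  total-branch leaf              = refl
  total-branch (node _ (t ∷ ts)) = trans
    (cong suc (sum-++ (init-leaves t ts) (concat (map proj₁ (rightBranchˡ t ts)))))
    (total-branchˡ t ts)
  total-branchˡ t []       = trans (total-branch t) (sym (+-identityʳ _))
  total-branchˡ t (u ∷ us) = begin
    suc (leaves t + i + r)   ≡⟨ cong suc (+-assoc (leaves t) i r) ⟩
    suc (leaves t + (i + r)) ≡⟨ cong suc (+-comm (leaves t) _) ⟩
    suc (i + r + leaves t)   ≡⟨ cong (_+ leaves t) (total-branchˡ u us) ⟩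
    leavesˡ (u ∷ us) + leaves t ≡⟨ +-comm _ (leaves t) ⟩
    leaves t + leavesˡ (u ∷ us) ∎
    where
    open ≡-Reasoning
    i = sum (init-leaves u us)
    r = total (rightBranchˡ u us)

  branch∈paths  : (t : Tree A) → map proj₂ (rightBranch t) ∈ₗ paths t
  branch∈pathsˡ : ∀ (t : Tree A) ts →
                  map proj₂ (rightBranchˡ t ts) ∈ₗ paths t ++ pathsˡ ts
  branch∈paths leaf              = here refl
  branch∈paths (node x (t ∷ ts)) = ∈-map⁺ (x ∷_) (branch∈pathsˡ t ts)
  branch∈pathsˡ t []       = ∈-++⁺ˡ (branch∈paths t)
  branch∈pathsˡ t (u ∷ us) = ∈-++⁺ʳ (paths t) (branch∈pathsˡ u us)

  module _ {P : A → ℕ → Set} where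

    branch-all  : ∀ {t} → AllNodes P t →
                  All (λ (s , x) → P x (suc (length s))) (rightBranch t)
    branch-allˡ : ∀ {t ts} → AllNodes P t → All (AllNodes P) ts →
                  All (λ (s , x) → P x (suc (length s))) (rightBranchˡ t ts)
    length-init : ∀ (t : Tree A) ts → length (init-leaves t ts) ≡ length ts
    branch-all leaf = []
    branch-all (node {x} {t ∷ ts} p (q ∷ qs)) =
      subst (P x ∘ suc) (sym (length-init t ts)) p ∷ branch-allˡ q qs
    branch-allˡ q []        = branch-all q
    branch-allˡ q (q′ ∷ qs) = branch-allˡ q′ qs
    length-init t []       = refl
    length-init t (u ∷ us) = cong suc (length-init u us)

  Disjoint-sym : {p q : Subset m} → Disjoint p q → Disjoint q p
  Disjoint-sym {p = p} {q} = subst Empty (∩-comm p q)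

  Disjoint-⊥ : (q : Subset m) → Disjoint ⊥ q
  Disjoint-⊥ q (x , x∈) = ∉⊥ (subst (x ∈_) (∩-zeroˡ q) x∈)

  All-↭ : {P : A → Set} {xs ys : List A} → xs ↭ ys → All P xs → All P ys
  All-↭ ↭.refl         ps            = ps
  All-↭ (↭.prep _ r)   (p ∷ ps)      = p ∷ All-↭ r ps
  All-↭ (↭.swap _ _ r) (p ∷ q ∷ ps)  = q ∷ p ∷ All-↭ r ps
  All-↭ (↭.trans r s)  ps            = All-↭ s (All-↭ r ps)

  AllPairs-↭ : {ps qs : List (Subset m)} → ps ↭ qs →
               AllPairs Disjoint ps → AllPairs Disjoint qs
  AllPairs-↭ ↭.refl         ds = ds
  AllPairs-↭ (↭.prep _ r)   (d ∷ ds) = All-↭ r d ∷ AllPairs-↭ r ds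
  AllPairs-↭ (↭.swap _ _ r) ((d ∷ d₁) ∷ d₂ ∷ ds) =
    (Disjoint-sym d ∷ All-↭ r d₂) ∷ All-↭ r d₁ ∷ AllPairs-↭ r ds
  AllPairs-↭ (↭.trans r s)  ds = AllPairs-↭ s (AllPairs-↭ r ds)

  ⋃-↭ : {ps qs : List (Subset m)} → ps ↭ qs → ⋃ ps ≡ ⋃ qs
  ⋃-↭ ↭.refl         = refl
  ⋃-↭ (↭.prep p r)   = cong (p ∪_) (⋃-↭ r)
  ⋃-↭ (↭.swap {xs} {ys} p q r) = begin
    p ∪ (q ∪ ⋃ xs) ≡⟨ cong (λ z → p ∪ (q ∪ z)) (⋃-↭ r) ⟩
    p ∪ (q ∪ ⋃ ys) ≡⟨ ∪-assoc p q _ ⟨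
    (p ∪ q) ∪ ⋃ ys ≡⟨ cong (_∪ ⋃ ys) (∪-comm p q) ⟩
    (q ∪ p) ∪ ⋃ ys ≡⟨ ∪-assoc q p _ ⟩
    q ∪ (p ∪ ⋃ ys) ∎
    where open ≡-Reasoning
  ⋃-↭ (↭.trans r s)  = trans (⋃-↭ r) (⋃-↭ s)

  IsPartition-↭ : {ps qs : List (Subset m)} → ps ↭ qs → IsPartition ps → IsPartition qs
  IsPartition-↭ r (mkPartition d c) = mkPartition (AllPairs-↭ r d) (trans (sym (⋃-↭ r)) c)

  module _ (f : A → Subset m) where

    private
      g : Maybe A → Subset m
      g = maybe′ f ⊥

    All-maybe : ∀ {p} xs → All (Disjoint p) (map f (catMaybes xs)) → All (Disjoint p) (map g xs)
    All-maybe []             []       = []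
    All-maybe (just x  ∷ xs) (d ∷ ds) = d ∷ All-maybe xs ds
    All-maybe (nothing ∷ xs) ds       = Disjoint-sym (Disjoint-⊥ _) ∷ All-maybe xs ds

    AllPairs-maybe : ∀ xs → AllPairs Disjoint (map f (catMaybes xs)) → AllPairs Disjoint (map g xs)
    AllPairs-maybe []             []       = []
    AllPairs-maybe (just x  ∷ xs) (d ∷ ds) = All-maybe xs d ∷ AllPairs-maybe xs ds
    AllPairs-maybe (nothing ∷ xs) ds       =
      All.universal Disjoint-⊥ (map g xs) ∷ AllPairs-maybe xs ds

    ⋃-maybe : ∀ xs → ⋃ (map g xs) ≡ ⋃ (map f (catMaybes xs))
    ⋃-maybe []             = refl
    ⋃-maybe (just x  ∷ xs) = cong (f x ∪_) (⋃-maybe xs)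
    ⋃-maybe (nothing ∷ xs) = trans (∪-identityˡ _) (⋃-maybe xs)

    IsPartition-maybe : ∀ xs → IsPartition (map f (catMaybes xs)) → IsPartition (map g xs)
    IsPartition-maybe xs (mkPartition d c) =
      mkPartition (AllPairs-maybe xs d) (trans (⋃-maybe xs) c)

  map-lookup-allFin : (v : Vec A k) → map (lookup v) (allFin k) ≡ Vec.toList v
  map-lookup-allFin {k = k} v = trans (map-tabulate {n = k} (λ i → i) (lookup v)) (tab v)
    where
    tab : ∀ {k} (v : Vec A k) → tabulate (lookup v) ≡ Vec.toList v
    tab Vec.[]      = refl
    tab (x Vec.∷ v) = cong (x ∷_) (tab v)

  shadow-partition : (μ : Vec (Subset m) k) (es : List (List ℕ × Maybe (Fin k))) →
    catMaybes (map proj₂ es) ≡ reverse (allFin k) → IsPartition (Vec.toList μ) →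
    IsPartition (map proj₂ (map (shadowEntry μ) es))
  shadow-partition {k = k} μ es cuts part =
    subst IsPartition (trans (sym (map-∘ es)) (map-∘ es))
      (IsPartition-maybe (lookup μ) (map proj₂ es)
        (subst IsPartition
          (trans (sym (reverse-map (lookup μ) (allFin k))) (cong (map (lookup μ)) (sym cuts)))
          (IsPartition-↭ (↭-sym (↭-reverse _))
            (subst IsPartition (sym (map-lookup-allFin μ)) part))))

  shadow-isShade : ∀ {n} (t : MarkedTree k) (μ : Vec (Subset m) k) →
                   IsPainted n t μ → IsShade n (shadowEntries t μ)
  shadow-isShade {n = n} t μ P = mkShade
    (map⁺ (branch>0 t))
    (trans (cong (sum ∘ concat) (sym (map-∘ (rightBranch t))))
           (suc-injective (trans (total-branch t) size)))
    (shadow-partition μ (rightBranch t) (All.lookup cuts (branch∈paths t)) partition)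
    (map⁺ (All.map nonempty-entry (branch-all unary-arities)))
    where
    open IsPainted P renaming (unary to unary-arities)
    nonempty-entry : ∀ {e} → (suc (length (proj₁ e)) ≡ 1 → Is-just (proj₂ e)) →
                     proj₁ e ≡ [] → Nonempty (maybe′ (lookup μ) ⊥ (proj₂ e))
    nonempty-entry {_ , just i}  _ _    = nonempty i
    nonempty-entry {_ , nothing} h refl with () ← h refl

  lookup-disjoint : (μ : Vec (Subset m) k) → AllPairs Disjoint (Vec.toList μ) →
                    ∀ {i j} → i ≢ j → Disjoint (lookup μ i) (lookup μ j)
  lookup-disjoint (p Vec.∷ μ) (d ∷ ds) {zero}  {zero}  i≢j = ⊥-elim (i≢j refl)
  lookup-disjoint (p Vec.∷ μ) (d ∷ ds) {zero}  {suc j} i≢j = at μ d j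
    where
    at : ∀ {k} (μ : Vec (Subset _) k) → All (Disjoint p) (Vec.toList μ) →
         ∀ j → Disjoint p (lookup μ j)
    at (q Vec.∷ μ) (d ∷ ds) zero    = d
    at (q Vec.∷ μ) (d ∷ ds) (suc j) = at μ ds j
  lookup-disjoint (p Vec.∷ μ) (d ∷ ds) {suc i} {zero}  i≢j =
    Disjoint-sym (lookup-disjoint (p Vec.∷ μ) (d ∷ ds) {zero} {suc i} (i≢j ∘ sym))
  lookup-disjoint (p Vec.∷ μ) (d ∷ ds) {suc i} {suc j} i≢j =
    lookup-disjoint μ ds (i≢j ∘ cong suc)

  singleton-parts : (μ : Vec (Subset m) m) → AllPairs Disjoint (Vec.toList μ) →
                    (∀ i → Nonempty (lookup μ i)) → ∀ i → ∃[ x ] lookup μ i ≡ ⁅ x ⁆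
  singleton-parts {m} μ disj ne i = f i , ⊆-antisym
    (λ y∈ → subst (_∈ ⁅ f i ⁆) (sym (unique y∈)) (x∈⁅x⁆ _))
    (λ y∈ → subst (_∈ lookup μ i) (sym (x∈⁅y⁆⇒x≡y _ y∈)) (proj₂ (ne i)))
    where
    f : Fin m → Fin m
    f = proj₁ ∘ ne

    same : ∀ {x i j} → x ∈ lookup μ i → x ∈ lookup μ j → i ≡ j
    same {x} {i} {j} x∈i x∈j with i ≟ᶠ j
    ... | yes i≡j = i≡j
    ... | no  i≢j = ⊥-elim (lookup-disjoint μ disj i≢j (x , x∈p∩q⁺ (x∈i , x∈j)))

    unique : ∀ {y} → y ∈ lookup μ i → y ≡ f i
    unique {y} y∈ with y ≟ᶠ f i
    ... | yes y≡ = y≡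
    ... | no  y≢ = ⊥-elim (clash (pigeonhole {m} {suc m} ≤-refl g))
      where
      g : Fin (suc m) → Fin m
      g zero    = y
      g (suc j) = f j
      clash : (∃[ a ] ∃[ b ] a Fin.< b × g a ≡ g b) → _
      clash (zero  , suc b , _ , y≡fb) =
        y≢ (trans y≡fb (cong f (same (subst (_∈ lookup μ b) (sym y≡fb) (proj₂ (ne b))) y∈)))
      clash (suc a , suc b , s≤s a<b , fa≡fb) =
        contradiction (cong toℕ (same (proj₂ (ne a)) (subst (_∈ lookup μ b) (sym fa≡fb) (proj₂ (ne b)))))
                      (<⇒≢ a<b)

  shadow-unary : ∀ (t : MarkedTree k) (μ : Vec (Subset m) k) →
    .(p : IsPainted n t μ) → IsPainted n t μ → IsBinary (painted t μ p) →
    All (λ (s , c) → (s ≡ [] × ∃[ x ] c ≡ ⁅ x ⁆) ⊎ (c ≡ ⊥ × ∃[ r ] s ≡ r ∷ []))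
        (shadowEntries t μ)
  shadow-unary t μ _ P (mkBinary refl arities) = map⁺ (All.map entry (branch-all arities))
    where
    open IsPainted P
    entry : ∀ {e} → (Is-just (proj₂ e) → suc (length (proj₁ e)) ≡ 1) ×
                    (Is-nothing (proj₂ e) → suc (length (proj₁ e)) ≡ 2) →
            let (s , c) = shadowEntry μ e in
            (s ≡ [] × ∃[ x ] c ≡ ⁅ x ⁆) ⊎ (c ≡ ⊥ × ∃[ r ] s ≡ r ∷ [])
    entry {[]        , just i}  _ = inj₁ (refl , singleton-parts μ (IsPartition.disjoint partition) nonempty i)
    entry {_ ∷ _     , just i}  (h , _) with () ← h (just tt)
    entry {[]        , nothing} (_ , h) with () ← h nothing
    entry {r ∷ []    , nothing} _ = inj₂ (refl , r , refl)
    entry {_ ∷ _ ∷ _ , nothing} (_ , h) with () ← h nothing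

open ShadowProperties using (shadow-isShade; shadow-unary)

shadow : PaintedTree m n → Shade m n
shadow (painted t μ p) = shade (shadowEntries t μ) (shadow-isShade t μ p)

Sh : BinaryPaintedTree m n → UnaryShade m n
Sh (T@(painted t μ p) , [ b ]) = shadow T , [ shadow-unary t μ p p b ]

{-# OPTIONS --safe #-}

-- The shadow map has a lower adjoint, hence preserves all existing meets.  The
-- adjoint sends a shade S to the tree with shadow S in which every left subtree
-- hanging off the right branch is a left comb with all its cuts pushed down to its
-- leaves.  This tree is the least one with shadow S, because left combs are least in
-- the Tamari order and moving a cut upward goes up.  The adjoint is monotone because
-- each edge between shades lifts to an upward path of trees: splitting a tuple splits
-- a comb by rotations, moving a cut up pulls it out of a comb, and two cuts that are
-- consecutive on the right branch are adjacent everywhere in the lifted tree.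

module Submission where

open import Data.Nat.Base using (ℕ)
open import Data.Product.Base using (_×_)
open import Function.Definitions using (Surjective)
open import Relation.Binary.Lattice.Structures using (IsMeetSemilattice)
open import Relation.Binary.PropositionalEquality using (_≡_)
open import Defs

open import Data.Bool.Properties using () renaming (_≟_ to _≟ᵇ_)
open import Data.Fin.Base as Fin using (Fin; toℕ)
open import Data.Fin.Properties using (any?) renaming (_≟_ to _≟ᶠ_)
open import Data.Fin.Subset
  using (Subset; inside; outside; _∉_; _∪_; ⊥; ⊤; ⁅_⁆; ⋃; ∣_∣; Nonempty)
open import Data.Fin.Subset.Properties
  using (∉⊥; x∈⁅x⁆; x∈p∩q⁺; x∈p∪q⁻; ∪-identityˡ; ∣⊥∣≡0; ∣⊤∣≡n)
open import Data.Irrelevant using ([_])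
open import Data.List.Base
  using (List; []; _∷_; _++_; map; concat; catMaybes; allFin; reverse; length
        ; applyUpTo; downFrom; tabulate)
open import Data.List.NonEmpty.Base using (_∷_)
open import Data.List.Properties
  using (∷-injectiveˡ; ∷-injectiveʳ; map-∘; map-tabulate; reverse-map; reverse-upTo
        ; reverse-involutive; reverse-injective; length-reverse)
open import Data.List.Relation.Binary.Permutation.Propositional.Properties using (↭-reverse)
open import Data.List.Relation.Unary.All as All using (All; []; _∷_)
open import Data.List.Relation.Unary.All.Properties
  using (map⁺; map⁻; ++⁺; ++⁻ˡ; ++⁻ʳ; tabulate⁻)
open import Data.List.Relation.Unary.AllPairs as AllPairs using (AllPairs; []; _∷_)
open import Data.List.Relation.Unary.Linked as Linked using (Linked; _∷_)
import Data.List.Relation.Unary.Linked.Properties as LinkedP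
open import Data.List.Relation.Unary.Unique.Propositional using (Unique)
open import Data.Maybe using (Maybe; just; nothing; Is-just; Is-nothing)
open import Data.Maybe.Relation.Unary.All using (nothing; just)
open import Data.Maybe.Relation.Unary.Any using (just)
open import Data.Nat.Base using (zero; suc; _+_; _<_; _>_; s≤s; z≤n)
open import Data.Nat.ListAction using (sum)
open import Data.Nat.Properties
  using (+-identityʳ; +-assoc; +-comm; +-suc; suc-injective; <-trans; ≤-reflexive; <⇒≢; _<?_)
  renaming (_≟_ to _≟ⁿ_)
open import Data.Product.Base using (∃-syntax; Σ-syntax; _,_; proj₁; proj₂)
open import Data.Refinement using (_,_; value)
open import Data.Sum.Base using (_⊎_; inj₁; inj₂)
open import Data.Unit.Base using (tt)
open import Data.Vec.Base as Vec using (Vec; lookup; _[_]≔_)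
open import Data.Vec.Properties
  using (≡-dec; lookup∘update; lookup∘update′; toList-injective; toList∘fromList
        ; toList-cast; cast-is-id)
open import Function.Base using (_∘_)
open import Relation.Binary.Construct.Closure.Reflexive as Refl using (ReflClosure; [_]; refl)
open import Relation.Binary.Construct.Closure.ReflexiveTransitive as Star
  using (Star; ε; _◅_; _◅◅_)
open import Relation.Binary.PropositionalEquality
  using (_≢_; refl; sym; trans; cong; cong₂; subst; module ≡-Reasoning)
open import Relation.Nullary using (Dec; no; contradiction)
open import Relation.Nullary.Decidable using (recompute; map′)

open ShadowProperties
open Shade using (entries)

private variable
  k m n a r : ℕ
  L : List (Fin k)
  c i j : Fin k
  t t′ u u′ : MarkedTree k
  μ : Vec (Subset m) k
  es es′ : List (Entry m)

-- Binary painted trees: cuts and arities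

-- The cut and arity conditions of a binary painted tree in inductive form, where
-- L lists the cuts met by every path, from the root downward.

data Cuts {k : ℕ} : List (Fin k) → MarkedTree k → Set where
  leaf : Cuts [] leaf
  cut  : Cuts L t → Cuts (c ∷ L) (unary c t)
  fork : Cuts L t → Cuts L u → Cuts L (binary t u)

Arity : Maybe (Fin k) → ℕ → Set
Arity c p = (Is-just c → p ≡ 1) × (Is-nothing c → p ≡ 2)

module _ {P : List (Maybe (Fin k)) → Set} where

  paths-unary : ∀ t → All (P ∘ (just c ∷_)) (paths t) → All P (paths (unary c t))
  paths-unary t ps = map⁺ (++⁺ ps [])

  paths-binary : ∀ t u → All (P ∘ (nothing ∷_)) (paths t) →
                 All (P ∘ (nothing ∷_)) (paths u) → All P (paths (binary t u))
  paths-binary t u ps qs = map⁺ (++⁺ ps (++⁺ qs []))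

Cuts⇒paths : Cuts L t → All (λ path → catMaybes path ≡ L) (paths t)
Cuts⇒paths leaf                       = refl ∷ []
Cuts⇒paths (cut {t = t} d)            = paths-unary t (All.map (cong (_ ∷_)) (Cuts⇒paths d))
Cuts⇒paths (fork {t = t} {u = u} d e) = paths-binary t u (Cuts⇒paths d) (Cuts⇒paths e)

Cuts⇒arities : Cuts L t → AllNodes Arity t
Cuts⇒arities leaf       = leaf
Cuts⇒arities (cut d)    = node ((λ _ → refl) , λ { (just ()) }) (Cuts⇒arities d ∷ [])
Cuts⇒arities (fork d e) = node ((λ ()) , λ _ → refl) (Cuts⇒arities d ∷ Cuts⇒arities e ∷ [])

Cuts⇒unary : Cuts L t → AllNodes (λ c p → p ≡ 1 → Is-just c) t
Cuts⇒unary leaf       = leaf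
Cuts⇒unary (cut d)    = node (λ _ → just tt) (Cuts⇒unary d ∷ [])
Cuts⇒unary (fork d e) = node (λ ()) (Cuts⇒unary d ∷ Cuts⇒unary e ∷ [])

paths⇒Cuts : AllNodes Arity t → All (λ path → catMaybes path ≡ L) (paths t) → Cuts L t
paths⇒Cuts leaf (refl ∷ []) = leaf
paths⇒Cuts (node {just c}  {_ ∷ _ ∷ _}     (h , _) _) _ with () ← h (just tt)
paths⇒Cuts (node {nothing} {_ ∷ []}        (_ , h) _) _ with () ← h nothing
paths⇒Cuts (node {nothing} {_ ∷ _ ∷ _ ∷ _} (_ , h) _) _ with () ← h nothing
paths⇒Cuts (node {nothing} {t ∷ u ∷ []} _ (p ∷ q ∷ [])) ps =
  fork (paths⇒Cuts p (++⁻ˡ (paths t) (map⁻ ps)))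
       (paths⇒Cuts q (++⁻ˡ (paths u) (++⁻ʳ (paths t) (map⁻ ps))))
paths⇒Cuts (node {just c} {t ∷ []} _ (p ∷ [])) ps
  with qs ← ++⁻ˡ (paths t) (map⁻ ps)
  -- `L` is read off one path of `t`, the right branch: it is `c` followed by the cuts on that path.
  with refl ← All.lookup qs (branch∈paths t) =
  cut (paths⇒Cuts p (All.map ∷-injectiveʳ qs))

cut-head : Cuts (i ∷ L) (unary j t) → i ≡ j
cut-head (cut _) = refl

cut-tail : Cuts (i ∷ L) (unary j t) → Cuts L t
cut-tail (cut d) = d

fork-left : Cuts L (binary t u) → Cuts L t
fork-left (fork d _) = d

fork-right : Cuts L (binary t u) → Cuts L u
fork-right (fork _ e) = e

-- Validity proofs are irrelevant, so the derivation is rebuilt from `t` and `L`: the irrelevant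
-- argument rules out the impossible shapes, and decidable equality of indices recovers the
-- agreement of each cut with the head of `L`.
recomputeCuts : ∀ t → .(Cuts L t) → Cuts L t
recomputeCuts {L = []}    leaf d = leaf
recomputeCuts {L = _ ∷ _} leaf ()
recomputeCuts {L = []}    (unary c t) ()
recomputeCuts {L = c′ ∷ L} (unary c t) d
  with refl ← recompute (c′ ≟ᶠ c) (cut-head d) = cut (recomputeCuts t (cut-tail d))
recomputeCuts (node (just c) (_ ∷ _ ∷ _)) ()
recomputeCuts (node nothing (_ ∷ [])) ()
recomputeCuts (binary t u) d =
  fork (recomputeCuts t (fork-left d)) (recomputeCuts u (fork-right d))
recomputeCuts (node nothing (_ ∷ _ ∷ _ ∷ _)) ()

-- Effect of a tree edge on cuts and leaf numbers

⟶ᵗ-Cuts : t ⟶ᵗ t′ → Cuts L t → Cuts L t′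
⟶ᵗ-Cuts rotate    (fork (fork d e) f)      = fork d (fork e f)
⟶ᵗ-Cuts moveCut   (fork (cut d) (cut e))   = cut (fork d e)
⟶ᵗ-Cuts (below s) (cut d)                  = cut (⟶ᵗ-Cuts s d)
⟶ᵗ-Cuts (left s)  (fork d e)               = fork (⟶ᵗ-Cuts s d) e
⟶ᵗ-Cuts (right s) (fork d e)               = fork d (⟶ᵗ-Cuts s e)

leaves-binary : (t u : MarkedTree k) → leaves (binary t u) ≡ leaves t + leaves u
leaves-binary t u = cong (leaves t +_) (+-identityʳ _)

leaves-unary : (c : Fin k) (t : MarkedTree k) → leaves (unary c t) ≡ leaves t
leaves-unary c t = +-identityʳ (leaves t)

⟶ᵗ-leaves : t ⟶ᵗ t′ → leaves t ≡ leaves t′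
⟶ᵗ-leaves (rotate {t₁} {t₂} {t₃})
  rewrite +-identityʳ (leaves t₂) | +-identityʳ (leaves t₃) | +-identityʳ (leaves t₂ + leaves t₃) =
  +-assoc (leaves t₁) (leaves t₂) (leaves t₃)
⟶ᵗ-leaves (moveCut {t₁ = t₁} {t₂})
  rewrite +-identityʳ (leaves t₁) | +-identityʳ (leaves t₂) | +-identityʳ (leaves t₂) =
  sym (+-identityʳ _)
⟶ᵗ-leaves (below s)         = cong (_+ 0) (⟶ᵗ-leaves s)
⟶ᵗ-leaves (left s)          = cong (_+ _) (⟶ᵗ-leaves s)
⟶ᵗ-leaves (right {t = t} s) = cong (λ l → leaves t + (l + 0)) (⟶ᵗ-leaves s)

-- Order of the cuts along a path

cutsDown : ∀ k → List (Fin k)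
cutsDown k = reverse (allFin k)

-- Under `toℕ` the list becomes `downFrom k`. This turns consecutive cuts on a path into the index
-- condition of `exchange`.
cutsDown-consecutive : ∀ k → Linked (λ j i → toℕ j ≡ suc (toℕ i)) (cutsDown k)
cutsDown-consecutive k = LinkedP.map⁻ (subst (Linked (λ j i → j ≡ suc i)) (sym eq)
  (LinkedP.applyDownFrom⁺₂ _ k (λ _ → refl)))
  where
  tabulate-toℕ : ∀ (f : ℕ → ℕ) k → tabulate {n = k} (f ∘ toℕ) ≡ applyUpTo f k
  tabulate-toℕ f zero    = refl
  tabulate-toℕ f (suc k) = cong (f 0 ∷_) (tabulate-toℕ (f ∘ suc) k)
  open ≡-Reasoning
  eq : map toℕ (cutsDown k) ≡ downFrom k
  eq = begin
    map toℕ (reverse (allFin k)) ≡⟨ reverse-map toℕ (allFin k) ⟩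
    reverse (map toℕ (allFin k)) ≡⟨ cong reverse (map-tabulate {n = k} (λ i → i) toℕ) ⟩
    reverse (tabulate {n = k} toℕ) ≡⟨ cong reverse (tabulate-toℕ (λ i → i) k) ⟩
    reverse (applyUpTo (λ i → i) k) ≡⟨ reverse-upTo k ⟩
    downFrom k ∎

cutsDown-unique : ∀ k → Unique (cutsDown k)
cutsDown-unique k = AllPairs.map (λ j>i j≡i → <⇒≢ j>i (cong toℕ (sym j≡i)))
  (LinkedP.Linked⇒AllPairs {R = λ j i → toℕ j > toℕ i} (λ p q → <-trans q p)
    (Linked.map {R = λ j i → toℕ j ≡ suc (toℕ i)} (≤-reflexive ∘ sym) (cutsDown-consecutive k)))

labels-cutsDown : (μ : Vec (Subset m) k) → map (lookup μ) (cutsDown k) ≡ reverse (Vec.toList μ)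
labels-cutsDown {k = k} μ =
  trans (reverse-map (lookup μ) (allFin k)) (cong reverse (map-lookup-allFin μ))

-- Left combs

-- comb a L has a + 1 leaves and all the cuts L just above each leaf.

chain : List (Fin k) → MarkedTree k
chain []      = leaf
chain (c ∷ L) = unary c (chain L)

comb : ℕ → List (Fin k) → MarkedTree k
comb zero    L = chain L
comb (suc a) L = binary (comb a L) (chain L)

chain-Cuts : (L : List (Fin k)) → Cuts L (chain L)
chain-Cuts []      = leaf
chain-Cuts (c ∷ L) = cut (chain-Cuts L)

comb-Cuts : ∀ a (L : List (Fin k)) → Cuts L (comb a L)
comb-Cuts zero    L = chain-Cuts L
comb-Cuts (suc a) L = fork (comb-Cuts a L) (chain-Cuts L)

leaves-chain : (L : List (Fin k)) → leaves (chain L) ≡ 1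
leaves-chain []      = refl
leaves-chain (c ∷ L) = trans (leaves-unary c (chain L)) (leaves-chain L)

leaves-comb : ∀ a (L : List (Fin k)) → leaves (comb a L) ≡ suc a
leaves-comb zero    L = leaves-chain L
leaves-comb (suc a) L = begin
  leaves (comb (suc a) L)             ≡⟨ leaves-binary (comb a L) (chain L) ⟩
  leaves (comb a L) + leaves (chain L) ≡⟨ cong₂ _+_ (leaves-comb a L) (leaves-chain L) ⟩
  suc a + 1                           ≡⟨ +-comm (suc a) 1 ⟩
  suc (suc a)                         ∎
  where open ≡-Reasoning

infix 4 _⟶ᵗ*_

_⟶ᵗ*_ : MarkedTree k → MarkedTree k → Set
_⟶ᵗ*_ = Star _⟶ᵗ_

below* : t ⟶ᵗ* t′ → unary c t ⟶ᵗ* unary c t′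
below* = Star.gmap _ below

left* : t ⟶ᵗ* t′ → binary t u ⟶ᵗ* binary t′ u
left* = Star.gmap _ left

right* : u ⟶ᵗ* u′ → binary t u ⟶ᵗ* binary t u′
right* = Star.gmap _ right

-- The cut climbs the left spine of the comb: the right child of every node on it starts with `c`,
-- so `moveCut` applies as soon as the left child does too.
comb-pushCut : ∀ a (L : List (Fin k)) → comb a (c ∷ L) ⟶ᵗ* unary c (comb a L)
comb-pushCut zero    L = ε
comb-pushCut (suc a) L = left* (comb-pushCut a L) ◅◅ moveCut ◅ ε

-- Each further leaf of the second comb costs one rotation: the left child is split first, then the
-- last leaf joins the second comb.
comb-split : ∀ a b (L : List (Fin k)) → comb (suc (b + a)) L ⟶ᵗ* binary (comb a L) (comb b L)
comb-split a zero    L = ε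
comb-split a (suc b) L = left* (comb-split a b L) ◅◅ rotate ◅ ε

comb-split′ : ∀ a b (L : List (Fin k)) → comb (a + suc b) L ⟶ᵗ* binary (comb a L) (comb b L)
comb-split′ a b L = subst (λ l → comb l L ⟶ᵗ* binary (comb a L) (comb b L))
  (trans (cong suc (+-comm b a)) (sym (+-suc a b))) (comb-split a b L)

-- Induction on the derivation: a cut at the root of `t` is pulled up through the whole comb, and a
-- binary root splits the comb according to the leaf numbers of its two subtrees.
comb-least : Cuts L t → leaves t ≡ suc a → comb a L ⟶ᵗ* t
comb-least leaf refl = ε
comb-least {a = a} (cut {L = L} {t = t} {c = c} d) eq =
  comb-pushCut a L ◅◅ below* (comb-least d (trans (sym (leaves-unary c t)) eq))
comb-least {a = a} (fork {L = L} {t = t} {u = u} d e) eq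
  with leaves t in eqt | leaves u in eqᵤ | leaves>0 t | leaves>0 u
... | suc b | suc b′ | _ | _ =
  -- With `b + 1` and `b′ + 1` leaves in the subtrees, the comb has index `b + suc b′`.
  subst (λ a → comb a L ⟶ᵗ* binary t u)
    (trans (cong (b +_) (sym (+-identityʳ (suc b′)))) (suc-injective eq))
    (comb-split′ b b′ L ◅◅ left* (comb-least d eqt) ◅◅ right* (comb-least e eqᵤ))

-- Labels of a shade and its lift to a tree

labels : List (Entry m) → List (Subset m)
labels []                  = []
labels (([]    , p) ∷ es) = p ∷ labels es
labels ((_ ∷ _ , _) ∷ es) = labels es

-- All paths meet the same cuts in the same order, so the cuts can be read on the right branch
-- alone.
Cuts⇒labels : ∀ (μ : Vec (Subset m) k) {L t} → Cuts L t →
              map (lookup μ) L ≡ labels (shadowEntries t μ)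
Cuts⇒labels μ leaf       = refl
Cuts⇒labels μ (cut d)    = cong (_ ∷_) (Cuts⇒labels μ d)
Cuts⇒labels μ (fork d e) = Cuts⇒labels μ e

-- The graph of the lower adjoint: t is the least tree whose shadow is es when its
-- cuts L carry the labels μ.

data Lift (μ : Vec (Subset m) k) : List (Fin k) → List (Entry m) → MarkedTree k → Set where
  end   : Lift μ [] [] leaf
  cut   : ∀ {p} → lookup μ c ≡ p → Lift μ L es t → Lift μ (c ∷ L) (([] , p) ∷ es) (unary c t)
  tuple : r ≡ suc a → Lift μ L es t → Lift μ L ((r ∷ [] , ⊥) ∷ es) (binary (comb a L) t)

Lift⇒Cuts : Lift μ L es t → Cuts L t
Lift⇒Cuts end                 = leaf
Lift⇒Cuts (cut _ l)           = cut (Lift⇒Cuts l)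
Lift⇒Cuts (tuple {a = a} _ l) = fork (comb-Cuts a _) (Lift⇒Cuts l)

Lift⇒shadow : Lift μ L es t → shadowEntries t μ ≡ es
Lift⇒shadow end                            = refl
Lift⇒shadow (cut refl l)                   = cong (_ ∷_) (Lift⇒shadow l)
Lift⇒shadow (tuple {a = a} {L = L} refl l) =
  cong₂ (λ r → (r ∷ [] , ⊥) ∷_) (leaves-comb a L) (Lift⇒shadow l)

Lift⇒labels : Lift μ L es t → map (lookup μ) L ≡ labels es
Lift⇒labels {μ = μ} l = trans (Cuts⇒labels μ (Lift⇒Cuts l)) (cong labels (Lift⇒shadow l))

UnaryEntry : Entry m → Set
UnaryEntry (s , c) = (s ≡ [] × ∃[ x ] c ≡ ⁅ x ⁆) ⊎ (c ≡ ⊥ × ∃[ r ] s ≡ r ∷ [])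

-- Recursion down the shade: the equation on labels hands out the cuts of `L` in step with the
-- entries, and positivity turns an entry `suc r` into a comb with `r + 1` leaves.
lift-exists : map (lookup μ) L ≡ labels es → All UnaryEntry es → All (All (0 <_) ∘ proj₁) es →
              ∃[ t ] Lift μ L es t
lift-exists {L = []} eq [] [] = leaf , end
lift-exists {L = []}    eq (inj₂ (refl , suc r , refl) ∷ us) ((s≤s z≤n ∷ []) ∷ ps)
  with t , l ← lift-exists eq us ps = binary (comb r []) t , tuple refl l
lift-exists {L = c ∷ L} eq (inj₂ (refl , suc r , refl) ∷ us) ((s≤s z≤n ∷ []) ∷ ps)
  with t , l ← lift-exists eq us ps = binary (comb r (c ∷ L)) t , tuple refl l
lift-exists {L = c ∷ L} eq (inj₁ (refl , x , refl) ∷ us) (_ ∷ ps)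
  with t , l ← lift-exists (∷-injectiveʳ eq) us ps = unary c t , cut (∷-injectiveˡ eq) l

-- Both trees have the same right branch, so they can differ only in the left subtrees, where
-- `comb-least` applies.
lift-least : Cuts L t → Lift μ L (shadowEntries t μ) u → u ⟶ᵗ* t
lift-least leaf       end          = ε
lift-least (cut d)    (cut _ l)    = below* (lift-least d l)
lift-least (fork d e) (tuple eq l) = left* (comb-least d eq) ◅◅ right* (lift-least e l)

-- Consecutive and adjacent cuts

data Consecutive (j i : Fin k) : List (Fin k) → Set where
  here  : Consecutive j i (j ∷ i ∷ L)
  there : Consecutive j i L → Consecutive j i (c ∷ L)

module _ {j i : Fin k} where

  Consecutive-Linked : ∀ {R : Fin k → Fin k → Set} → Linked R L → Consecutive j i L → R j i
  Consecutive-Linked (r ∷ _)  here      = r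
  Consecutive-Linked (_ ∷ rs) (there q) = Consecutive-Linked rs q

  Consecutive-All : ∀ {P : Fin k → Set} → All P L → Consecutive j i L → P j × P i
  Consecutive-All (p ∷ q ∷ _) here      = p , q
  Consecutive-All (_ ∷ ps)    (there q) = Consecutive-All ps q

  Adjacent-here : ∀ t → Adjacent j i (unary j (unary i t))
  Adjacent-here t = paths-unary (unary i t)
    (paths-unary t (All.universal (λ ys → [] , ys , refl) (paths t)))

  ∷-adjacent : ∀ {c : Maybe (Fin k)} {path} → ∃[ xs ] ∃[ ys ] path ≡ xs ++ just j ∷ just i ∷ ys →
               ∃[ xs ] ∃[ ys ] c ∷ path ≡ xs ++ just j ∷ just i ∷ ys
  ∷-adjacent {c} (xs , ys , refl) = c ∷ xs , ys , refl

  Adjacent-unary : Adjacent j i t → Adjacent j i (unary c t)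
  Adjacent-unary {t = t} ps = paths-unary t (All.map ∷-adjacent ps)

  Adjacent-binary : Adjacent j i t → Adjacent j i u → Adjacent j i (binary t u)
  Adjacent-binary {t = t} {u = u} ps qs =
    paths-binary t u (All.map ∷-adjacent ps) (All.map ∷-adjacent qs)

  Adjacent-chain : Consecutive j i L → Adjacent j i (chain L)
  Adjacent-chain (here {L = L}) = Adjacent-here (chain L)
  Adjacent-chain (there {L = L} {c = c} q) =
    Adjacent-unary {t = chain L} {c = c} (Adjacent-chain q)

  -- In a comb the cuts of `L` sit in chains below all the binary nodes, so no node separates two
  -- consecutive ones on any path.
  Adjacent-comb : ∀ a → Consecutive j i L → Adjacent j i (comb a L)
  Adjacent-comb         zero    q = Adjacent-chain q
  Adjacent-comb {L = L} (suc a) q =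
    Adjacent-binary {t = comb a L} {u = chain L} (Adjacent-comb a q) (Adjacent-chain q)

-- Exchanging two labels and lifting shade edges

module _ {j i : Fin k} (μ : Vec (Subset m) k) {p q : Subset m} where

  private
    μ′ : Vec (Subset m) k
    μ′ = μ [ j ]≔ p [ i ]≔ q

  relabel-lower : lookup μ′ i ≡ q
  relabel-lower = lookup∘update i (μ [ j ]≔ p) q

  relabel-upper : j ≢ i → lookup μ′ j ≡ p
  relabel-upper j≢i = trans (lookup∘update′ j≢i (μ [ j ]≔ p) q) (lookup∘update j μ p)

  relabel-other : c ≢ j → c ≢ i → lookup μ′ c ≡ lookup μ c
  relabel-other c≢j c≢i =
    trans (lookup∘update′ c≢i (μ [ j ]≔ p) q) (lookup∘update′ c≢j μ p)

Lift-relabel : ∀ {p q} → All (j ≢_) L → All (i ≢_) L → Lift μ L es t →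
               Lift (μ [ j ]≔ p [ i ]≔ q) L es t
Lift-relabel _ _ end = end
Lift-relabel {μ = μ} (j≢c ∷ js) (i≢c ∷ is) (cut eq l) =
  cut (trans (relabel-other μ (j≢c ∘ sym) (i≢c ∘ sym)) eq) (Lift-relabel js is l)
Lift-relabel js is (tuple eq l) = tuple eq (Lift-relabel js is l)

-- Splitting a tuple or moving a cut raises the tree under fixed labels, while exchanging labels
-- keeps the tree and changes `μ`.
data LiftStep {k m} (μ : Vec (Subset m) k) (L : List (Fin k)) (t : MarkedTree k)
              (es : List (Entry m)) : Set where
  onTree   : t ⟶ᵗ* t′ → Lift μ L es t′ → LiftStep μ L t es
  exchange : ∀ {j i x y} → Consecutive j i L → Adjacent j i t →
             lookup μ j ≡ ⁅ y ⁆ → lookup μ i ≡ ⁅ x ⁆ → x Fin.< y →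
             Lift (μ [ j ]≔ ⁅ x ⁆ [ i ]≔ ⁅ y ⁆) L es t → LiftStep μ L t es

-- Uniqueness of the cuts in `L` guarantees that an exchange leaves the labels of all other cuts of
-- the lift alone.
lift-step : Unique L → Lift μ L es t → es ⟶ᵉ es′ → LiftStep μ L t es′
lift-step {L = L} _ (tuple eq l) (split {suc s} {suc t} (s≤s _) (s≤s _)) with refl ← eq =
  -- The comb first splits in place; a rotation then moves its second part onto the right branch.
  onTree (left* (comb-split′ s t L) ◅◅ rotate ◅ ε) (tuple refl (tuple refl l))
lift-step {L = c ∷ L} _ (tuple {a = a} eq (cut eq′ l)) moveCut =
  -- The cut must reach the top of the comb before it can pass the node on the right branch.
  onTree (left* (comb-pushCut a L) ◅◅ moveCut ◅ ε) (cut eq′ (tuple eq l))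
lift-step {μ = μ} ((j≢i ∷ js) ∷ is ∷ _) (cut eq (cut {t = t} eq′ l)) (exchange x<y) =
  exchange here (Adjacent-here t) eq eq′ x<y
    (cut (relabel-upper μ j≢i) (cut (relabel-lower μ) (Lift-relabel js is l)))
lift-step {μ = μ} (c∉ ∷ uniq) (cut {c = c} {t = t} eq l) (below s) with lift-step uniq l s
... | onTree ts l′ = onTree (below* ts) (cut eq l′)
... | exchange q adj eqⱼ eqᵢ x<y l′ =
  exchange (there q) (Adjacent-unary {t = t} {c = c} adj) eqⱼ eqᵢ x<y
    (cut (let c≢j , c≢i = Consecutive-All c∉ q in trans (relabel-other μ c≢j c≢i) eq) l′)
lift-step uniq (tuple {a = a} {L = L} {t = t} eq l) (below s) with lift-step uniq l s
... | onTree ts l′ = onTree (right* ts) (tuple eq l′)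
... | exchange q adj eqⱼ eqᵢ x<y l′ =
  exchange q (Adjacent-binary {t = comb a L} {u = t} (Adjacent-comb a q) adj) eqⱼ eqᵢ x<y (tuple eq l′)

-- Shadows of tree edges

module _ {μ : Vec (Subset m) k} (singleton : ∀ c → ∃[ x ] lookup μ c ≡ ⁅ x ⁆) where

  -- A step on the right branch projects to the matching shade edge. A step inside a left subtree
  -- preserves its leaf number and so fixes the shadow, hence the reflexive closure.
  ⟶ᵗ-shadow : t ⟶ᵗ t′ → ReflClosure _⟶ᵉ_ (shadowEntries t μ) (shadowEntries t′ μ)
  ⟶ᵗ-shadow (rotate {t₁} {t₂}) rewrite +-identityʳ (leaves t₂) =
    [ split (leaves>0 t₁) (leaves>0 t₂) ]
  ⟶ᵗ-shadow (moveCut {c} {t₁}) rewrite +-identityʳ (leaves t₁) | proj₂ (singleton c) = [ moveCut ]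
  ⟶ᵗ-shadow (below {c} s) = Refl.map {f = ([] , lookup μ c) ∷_} below (⟶ᵗ-shadow s)
  ⟶ᵗ-shadow (left s) rewrite ⟶ᵗ-leaves s = refl
  ⟶ᵗ-shadow (right {t} s) = Refl.map {f = (leaves t ∷ [] , ⊥) ∷_} below (⟶ᵗ-shadow s)

shadow-relabel : ∀ (μ : Vec (Subset m) k) {p q} → All (j ≢_) L → All (i ≢_) L → Cuts L t →
                 shadowEntries t μ ≡ shadowEntries t (μ [ j ]≔ p [ i ]≔ q)
shadow-relabel μ _ _ leaf = refl
shadow-relabel μ (j≢c ∷ js) (i≢c ∷ is) (cut d) =
  cong₂ (λ p → ([] , p) ∷_) (sym (relabel-other μ (j≢c ∘ sym) (i≢c ∘ sym)))
    (shadow-relabel μ js is d)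
shadow-relabel μ js is (fork {t = t} d e) =
  cong ((leaves t ∷ [] , ⊥) ∷_) (shadow-relabel μ js is e)

Adjacent⇒Consecutive : ∀ xs {ys path} → path ≡ xs ++ just j ∷ just i ∷ ys →
                       Consecutive j i (catMaybes path)
Adjacent⇒Consecutive []             refl = here
Adjacent⇒Consecutive (just _  ∷ xs) refl = there (Adjacent⇒Consecutive xs refl)
Adjacent⇒Consecutive (nothing ∷ xs) refl = Adjacent⇒Consecutive xs refl

Cuts⇒branch : Cuts L t → catMaybes (map proj₂ (rightBranch t)) ≡ L
Cuts⇒branch {t = t} d = All.lookup (Cuts⇒paths d) (branch∈paths t)

exchange-shadow : ∀ (μ : Vec (Subset m) k) {x y} xs {ys} → Unique L → Cuts L t →
  map proj₂ (rightBranch t) ≡ xs ++ just j ∷ just i ∷ ys →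
  lookup μ j ≡ ⁅ y ⁆ → lookup μ i ≡ ⁅ x ⁆ → x Fin.< y →
  shadowEntries t μ ⟶ᵉ shadowEntries t (μ [ j ]≔ ⁅ x ⁆ [ i ]≔ ⁅ y ⁆)
exchange-shadow {i = i} μ {x} {y} [] ((j≢i ∷ js) ∷ is ∷ _) (cut {c = j} (cut d)) refl eqⱼ eqᵢ x<y
  rewrite sym (shadow-relabel μ {p = ⁅ x ⁆} {q = ⁅ y ⁆} js is d)
        | relabel-upper μ {⁅ x ⁆} {⁅ y ⁆} j≢i
        | relabel-lower {j = j} {i} μ {⁅ x ⁆} {⁅ y ⁆}
        | eqⱼ | eqᵢ = exchange x<y
exchange-shadow {j = j} {i = i} μ {x} {y} (_ ∷ xs) (c∉ ∷ uniq) (cut d) path≡ eqⱼ eqᵢ x<y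
  -- The exchanged cuts both occur further down, so by uniqueness the cut passed here is neither of
  -- them and keeps its label.
  with q ← subst (Consecutive j i) (Cuts⇒branch d) (Adjacent⇒Consecutive xs (∷-injectiveʳ path≡))
  with c≢j , c≢i ← Consecutive-All c∉ q
  rewrite relabel-other μ {⁅ x ⁆} {⁅ y ⁆} c≢j c≢i =
  below (exchange-shadow μ xs uniq d (∷-injectiveʳ path≡) eqⱼ eqᵢ x<y)
exchange-shadow μ (_ ∷ xs) uniq (fork d e) path≡ eqⱼ eqᵢ x<y =
  below (exchange-shadow μ xs uniq e (∷-injectiveʳ path≡) eqⱼ eqᵢ x<y)

-- Counting the labels of a unary shade

module _ {P : Subset m → Set} where

  All-labels : ∀ es → All P (map proj₂ es) → All P (labels es)
  All-labels []                 []       = []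
  All-labels (([] , _) ∷ es)    (p ∷ ps) = p ∷ All-labels es ps
  All-labels ((_ ∷ _ , _) ∷ es) (_ ∷ ps) = All-labels es ps

AllPairs-labels : ∀ {R : Subset m → Subset m → Set} es →
                  AllPairs R (map proj₂ es) → AllPairs R (labels es)
AllPairs-labels []                 []       = []
AllPairs-labels (([] , _) ∷ es)    (p ∷ ps) = All-labels es p ∷ AllPairs-labels es ps
AllPairs-labels ((_ ∷ _ , _) ∷ es) (_ ∷ ps) = AllPairs-labels es ps

⋃-labels : All UnaryEntry es → ⋃ (map proj₂ es) ≡ ⋃ (labels es)
⋃-labels []                             = refl
⋃-labels (inj₁ (refl , _) ∷ us)         = cong (_ ∪_) (⋃-labels us)
⋃-labels (inj₂ (refl , _ , refl) ∷ us) = trans (∪-identityˡ _) (⋃-labels us)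

labels-partition : All UnaryEntry es → IsPartition (map proj₂ es) → IsPartition (labels es)
labels-partition {es = es} us (mkPartition d c) =
  mkPartition (AllPairs-labels es d) (trans (sym (⋃-labels us)) c)

labels-singletons : All UnaryEntry es → All (λ p → ∃[ x ] p ≡ ⁅ x ⁆) (labels es)
labels-singletons []                            = []
labels-singletons (inj₁ (refl , p) ∷ us)        = p ∷ labels-singletons us
labels-singletons (inj₂ (_ , _ , refl) ∷ us)    = labels-singletons us

∣⁅x⁆∪p∣ : (x : Fin m) (p : Subset m) → x ∉ p → ∣ ⁅ x ⁆ ∪ p ∣ ≡ suc ∣ p ∣
∣⁅x⁆∪p∣ Fin.zero    (inside  Vec.∷ p) x∉p = contradiction Vec.here x∉p
∣⁅x⁆∪p∣ Fin.zero    (outside Vec.∷ p) x∉p = cong (suc ∘ ∣_∣) (∪-identityˡ p)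
∣⁅x⁆∪p∣ (Fin.suc x) (inside  Vec.∷ p) x∉p = cong suc (∣⁅x⁆∪p∣ x p (x∉p ∘ Vec.there))
∣⁅x⁆∪p∣ (Fin.suc x) (outside Vec.∷ p) x∉p = ∣⁅x⁆∪p∣ x p (x∉p ∘ Vec.there)

∉⋃ : ∀ {x : Fin m} {ps} → All (x ∉_) ps → x ∉ ⋃ ps
∉⋃ []             x∈ = ∉⊥ x∈
∉⋃ {ps = p ∷ ps} (x∉p ∷ x∉ps) x∈ with x∈p∪q⁻ p (⋃ ps) x∈
... | inj₁ x∈p  = x∉p x∈p
... | inj₂ x∈ps = ∉⋃ x∉ps x∈ps

∣⋃∣ : {ps : List (Subset m)} → AllPairs Disjoint ps → All (λ p → ∃[ x ] p ≡ ⁅ x ⁆) ps →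
      ∣ ⋃ ps ∣ ≡ length ps
∣⋃∣ {m = m} [] [] = ∣⊥∣≡0 m
∣⋃∣ {ps = _ ∷ ps} (d ∷ ds) ((x , refl) ∷ ss) = trans
  (∣⁅x⁆∪p∣ x (⋃ ps) (∉⋃ (All.map (λ disj x∈ → disj (x , x∈p∩q⁺ (x∈⁅x⁆ x , x∈))) d)))
  (cong suc (∣⋃∣ ds ss))

-- The labels are disjoint singletons with union `⊤`, so the cardinality of `⊤` counts them. This
-- gives the lift exactly `m` cuts.
length-labels : {es : List (Entry m)} → All UnaryEntry es → IsPartition (map proj₂ es) →
                length (labels es) ≡ m
length-labels {m = m} {es} us part = begin
  length (labels es) ≡⟨ ∣⋃∣ disjoint (labels-singletons us) ⟨
  ∣ ⋃ (labels es) ∣  ≡⟨ cong ∣_∣ covers ⟩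
  ∣ ⊤ {n = m} ∣     ≡⟨ ∣⊤∣≡n m ⟩
  m                 ∎
  where
  open ≡-Reasoning
  open IsPartition (labels-partition us part)

-- Passage to valid binary painted trees

shadow⇒painted : ∀ (μ : Vec (Subset m) k) → Cuts (cutsDown k) t →
                 All UnaryEntry (shadowEntries t μ) → IsShade n (shadowEntries t μ) →
                 IsPainted n t μ
shadow⇒painted {k = k} {t = t} μ d us sh = mkPainted
  -- The tuples of the shadow count all leaves but the rightmost.
  (trans (sym (total-branch t))
         (cong suc (trans (cong (sum ∘ concat) (map-∘ (rightBranch t))) (IsShade.total sh))))
  (Cuts⇒paths d)
  (Cuts⇒unary d)
  -- The right branch meets every cut, so the labels of the shadow are those of `μ` in reverse.
  (IsPartition-↭ (↭-reverse _)
    (subst IsPartition (trans (sym (Cuts⇒labels μ d)) (labels-cutsDown μ))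
      (labels-partition us (IsShade.partition sh))))
  (tabulate⁻ (All-↭ (↭-reverse (allFin k))
    (map⁻ (subst (All Nonempty) (sym (Cuts⇒labels μ d))
      (All.map (λ { (x , refl) → x , x∈⁅x⁆ x }) (labels-singletons us))))))

painted-step : ∀ {μ : Vec (Subset m) k} → t ⟶ᵗ t′ → Cuts (cutsDown k) t →
               IsPainted n t μ → IsPainted n t′ μ
painted-step s d P =
  mkPainted (trans (sym (⟶ᵗ-leaves s)) size) (Cuts⇒paths d′) (Cuts⇒unary d′) partition nonempty
  where
  open IsPainted P
  d′ = ⟶ᵗ-Cuts s d

-- Tree edges preserve `Cuts` and leaf numbers, so every intermediate tree is again a valid binary
-- painted tree.
⟶ᵗ*⇒≤ᵖ : ∀ {μ : Vec (Subset m) m} → t ⟶ᵗ* t′ → Cuts (cutsDown m) t →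
  .(p : IsPainted n t μ) .(b : IsBinary (painted t μ p))
  .(p′ : IsPainted n t′ μ) .(b′ : IsBinary (painted t′ μ p′)) →
  _≤ᵖ_ {m} {n} (painted t μ p , [ b ]) (painted t′ μ p′ , [ b′ ])
⟶ᵗ*⇒≤ᵖ ε        d p b p′ b′ = ε
⟶ᵗ*⇒≤ᵖ (s ◅ ss) d p b p′ b′ = onTree s ◅
  ⟶ᵗ*⇒≤ᵖ ss (⟶ᵗ-Cuts s d) (painted-step s d p) (mkBinary refl (Cuts⇒arities (⟶ᵗ-Cuts s d))) p′ b′

-- What the irrelevant proofs certify, in usable form: the number of cuts becomes `m`
-- definitionally, and a relevant derivation of `Cuts` comes with it.
data View {m n : ℕ} : BinaryPaintedTree m n → Set where
  view : ∀ {t μ} .(p : IsPainted n t μ) .(b : IsBinary (painted t μ p)) →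
         Cuts (cutsDown m) t → View (painted t μ p , [ b ])

toView : (T : BinaryPaintedTree m n) → View T
toView {m} (painted {k} t μ p , [ b ]) with refl ← recompute (k ≟ⁿ m) (IsBinary.#cuts≡m b) =
  view p b (recomputeCuts t (paths⇒Cuts (IsBinary.arities b) (IsPainted.cuts p)))

singletons : (μ : Vec (Subset m) m) → .(IsPainted n t μ) → ∀ c → ∃[ x ] lookup μ c ≡ ⁅ x ⁆
singletons μ p c = recompute (any? λ x → ≡-dec _≟ᵇ_ (lookup μ c) ⁅ x ⁆)
  (singleton-parts μ (IsPartition.disjoint (IsPainted.partition p)) (IsPainted.nonempty p) c)

entries-injective : {S S′ : UnaryShade m n} → entries (value S) ≡ entries (value S′) → S ≡ S′
entries-injective {S = shade _ _ , [ _ ]} {S′ = shade _ _ , [ _ ]} refl = refl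

entries-≤ˢ : (S S′ : UnaryShade m n) →
             ReflClosure _⟶ᵉ_ (entries (value S)) (entries (value S′)) → S ≤ˢ S′
entries-≤ˢ (shade _ _ , [ _ ]) (shade _ _ , [ _ ]) refl  = ε
entries-≤ˢ _                   _                   [ s ] = s ◅ ε

Sh-step : (T T′ : BinaryPaintedTree m n) → value T ⟶ᵖ value T′ → Sh T ≤ˢ Sh T′
Sh-step T T′ s with toView T
Sh-step T T′@(_ , [ _ ]) (onTree {μ = μ} s) | view p b d =
  entries-≤ˢ (Sh T) (Sh T′) (⟶ᵗ-shadow {μ = μ} (singletons μ p) s)
Sh-step T T′@(_ , [ _ ]) (exchange {t = t} {μ = μ} _ adj eqⱼ eqᵢ x<y) | view p b d
  -- Adjacency holds on every path; on the right branch it locates the two cuts in the shadow.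
  with xs , _ , path≡ ← All.lookup adj (branch∈paths t) =
  entries-≤ˢ (Sh T) (Sh T′) [ exchange-shadow μ xs (cutsDown-unique _) d path≡ eqⱼ eqᵢ x<y ]

Sh-mono : (T T′ : BinaryPaintedTree m n) → T ≤ᵖ T′ → Sh T ≤ˢ Sh T′
Sh-mono T T′ ε = ε
Sh-mono T T′ (_◅_ {j = T₁} s ss) = Sh-step T T₁ s ◅◅ Sh-mono T₁ T′ ss

-- The lower adjoint

Lifting : Vec (Subset m) m → UnaryShade m n → MarkedTree m → Set
Lifting {m} μ S t = Lift μ (cutsDown m) (entries (value S)) t

lifted : ∀ {μ} (S : UnaryShade m n) → Lifting μ S t → BinaryPaintedTree m n
lifted {n = n} {t = t} {μ = μ} (shade es sh , [ us ]) l =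
  painted t μ (shadow⇒painted μ (Lift⇒Cuts l)
                (subst (All UnaryEntry) (sym (Lift⇒shadow l)) us)
                (subst (IsShade n) (sym (Lift⇒shadow l)) sh)) ,
  [ mkBinary refl (Cuts⇒arities (Lift⇒Cuts l)) ]

Sh-lifted : ∀ {μ} (S : UnaryShade m n) (l : Lifting μ S t) → Sh (lifted S l) ≡ S
Sh-lifted S@(shade es sh , [ us ]) l = entries-injective {S = Sh (lifted S l)} {S} (Lift⇒shadow l)

lifted-step : ∀ {μ} (S S′ : UnaryShade m n) → entries (value S) ⟶ᵉ entries (value S′) →
  (l : Lifting μ S t) → ∃[ μ′ ] ∃[ t′ ] Σ[ l′ ∈ Lifting μ′ S′ t′ ] lifted S l ≤ᵖ lifted S′ l′
lifted-step {m} {μ = μ} (shade _ _ , [ _ ]) (shade _ _ , [ _ ]) s l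
  with lift-step (cutsDown-unique m) l s
... | onTree ts l′ = μ , _ , l′ , ⟶ᵗ*⇒≤ᵖ ts (Lift⇒Cuts l) _ _ _ _
... | exchange q adj eqⱼ eqᵢ x<y l′ =
  _ , _ , l′ , exchange (Consecutive-Linked (cutsDown-consecutive m) q) adj eqⱼ eqᵢ x<y ◅ ε

-- An edge may change the labelling and the tree, so each step returns the lift from which the next
-- one starts.
lifted-mono : ∀ {μ} (S S′ : UnaryShade m n) → S ≤ˢ S′ →
  (l : Lifting μ S t) → ∃[ μ′ ] ∃[ t′ ] Σ[ l′ ∈ Lifting μ′ S′ t′ ] lifted S l ≤ᵖ lifted S′ l′
lifted-mono S S′ ε l = _ , _ , l , ε
lifted-mono S S′ (_◅_ {j = S₁} s ss) l
  with _ , _ , l₁ , le₁ ← lifted-step S S₁ s l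
  with _ , _ , l′ , le′ ← lifted-mono S₁ S′ ss l₁ = _ , _ , l′ , le₁ ◅◅ le′

labels-injective : (μ μ′ : Vec (Subset m) k) →
                   map (lookup μ) (cutsDown k) ≡ map (lookup μ′) (cutsDown k) → μ ≡ μ′
labels-injective μ μ′ eq = trans (sym (cast-is-id refl μ)) (toList-injective refl μ μ′
  (reverse-injective (trans (sym (labels-cutsDown μ)) (trans eq (labels-cutsDown μ′)))))

lifted-least : ∀ {μ} (T : BinaryPaintedTree m n) (l : Lifting μ (Sh T) t) → lifted (Sh T) l ≤ᵖ T
lifted-least {μ = μ} T l with toView T
... | view {μ = μ′} p b d
  -- The lift and `T` have the same shadow, hence the same vector of labels.
  with refl ← labels-injective μ μ′ (trans (Lift⇒labels l) (sym (Cuts⇒labels μ′ d))) =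
  ⟶ᵗ*⇒≤ᵖ (lift-least d l) (Lift⇒Cuts l) _ _ p b

-- The path from `S` to `Sh T` lifts to a path ending at a lift of `Sh T`, which lies below `T`.
lifted-adjoint : ∀ {μ} (S : UnaryShade m n) (T : BinaryPaintedTree m n) (l : Lifting μ S t) →
                 S ≤ˢ Sh T → lifted S l ≤ᵖ T
lifted-adjoint S T l S≤ShT =
  let _ , _ , l′ , S≤′ = lifted-mono S (Sh T) S≤ShT l in S≤′ ◅◅ lifted-least T l′

-- Existence of lifts

unaryEntry? : (e : Entry m) → Dec (UnaryEntry e)
unaryEntry? ([] , p) = map′ (λ x → inj₁ (refl , x))
  (λ { (inj₁ (_ , x)) → x ; (inj₂ (_ , _ , ())) })
  (any? λ x → ≡-dec _≟ᵇ_ p ⁅ x ⁆)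
unaryEntry? (r ∷ [] , p) = map′ (λ p≡⊥ → inj₂ (p≡⊥ , r , refl))
  (λ { (inj₁ (() , _)) ; (inj₂ (p≡⊥ , _)) → p≡⊥ })
  (≡-dec _≟ᵇ_ p ⊥)
unaryEntry? (_ ∷ _ ∷ _ , p) = no λ { (inj₁ (() , _)) ; (inj₂ (_ , _ , ())) }

labels-surjective : (ps : List (Subset m)) → .(length ps ≡ k) →
                    ∃[ μ ] map (lookup μ) (cutsDown k) ≡ ps
labels-surjective {m} {k} ps len = ν , (begin
  map (lookup ν) (cutsDown k)                      ≡⟨ labels-cutsDown ν ⟩
  reverse (Vec.toList ν)                           ≡⟨ cong reverse (toList-cast len′ (Vec.fromList (reverse ps))) ⟩
  reverse (Vec.toList (Vec.fromList (reverse ps))) ≡⟨ cong reverse (toList∘fromList (reverse ps)) ⟩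
  reverse (reverse ps)                             ≡⟨ reverse-involutive ps ⟩
  ps                                               ∎)
  where
  open ≡-Reasoning
  len′ : length (reverse ps) ≡ k
  len′ = trans (length-reverse ps) (recompute (_ ≟ⁿ _) len)
  ν : Vec (Subset m) k
  -- `ps` starts with the highest cut, whereas a vector of labels starts with the lowest, hence the
  -- reversal.
  ν = Vec.cast len′ (Vec.fromList (reverse ps))

lifting-exists : (S : UnaryShade m n) → ∃[ μ ] ∃[ t ] Lifting μ S t
lifting-exists (shade es sh , [ us ])
  with μ , eq ← labels-surjective (labels es) (length-labels us (IsShade.partition sh)) =
  -- Unarity and positivity are decidable, so relevant proofs are recomputed from the irrelevant
  -- ones.
  μ , lift-exists eq (recompute (All.all? unaryEntry? es) us)
                     (recompute (All.all? (All.all? (0 <?_) ∘ proj₁) es) (IsShade.positive sh))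

-- Surjectivity and preservation of meets

Sh-surjective : Surjective _≡_ _≡_ (Sh {m} {n})
Sh-surjective S with _ , _ , l ← lifting-exists S = lifted S l , λ { refl → Sh-lifted S l }

-- A lower bound `S` of the two shadows is the shadow of its lift; the adjunction puts that lift
-- below `T` and `T′`, hence below `M`, and monotonicity brings it back to the shades.
Sh-meet : (T T′ M : BinaryPaintedTree m n) →
          IsMeet _≤ᵖ_ T T′ M → IsMeet _≤ˢ_ (Sh T) (Sh T′) (Sh M)
Sh-meet T T′ M (M≤T , M≤T′ , greatest) = Sh-mono M T M≤T , Sh-mono M T′ M≤T′ , below-Sh-M
  where
  below-Sh-M : ∀ S → S ≤ˢ Sh T → S ≤ˢ Sh T′ → S ≤ˢ Sh M
  below-Sh-M S S≤ S≤′ with _ , _ , l ← lifting-exists S =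
    subst (_≤ˢ Sh M) (Sh-lifted S l)
      (Sh-mono (lifted S l) M
        (greatest (lifted S l) (lifted-adjoint S T l S≤) (lifted-adjoint S T′ l S≤′)))

IsMeet-unique : ∀ {A : Set} {_≤_ : A → A → Set} → (∀ {x y} → x ≤ y → y ≤ x → x ≡ y) →
                ∀ {x y z z′} → IsMeet _≤_ x y z → IsMeet _≤_ x y z′ → z ≡ z′
IsMeet-unique antisym (z≤x , z≤y , max) (z′≤x , z′≤y , max′) =
  antisym (max′ _ z≤x z≤y) (max _ z′≤x z′≤y)

proposition38 : (m n : ℕ) →
    Surjective _≡_ _≡_ (Sh {m} {n})
    × (∀ (T T′ M : BinaryPaintedTree m n) →
    IsMeet _≤ᵖ_ T T′ M → IsMeet _≤ˢ_ (Sh T) (Sh T′) (Sh M))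
    × (∀ (_∧ᵖ_ : BinaryPaintedTree m n → BinaryPaintedTree m n → BinaryPaintedTree m n)
    (_∧ˢ_ : UnaryShade m n → UnaryShade m n → UnaryShade m n) →
    IsMeetSemilattice _≡_ _≤ᵖ_ _∧ᵖ_ → IsMeetSemilattice _≡_ _≤ˢ_ _∧ˢ_ →
    ∀ T T′ → Sh (T ∧ᵖ T′) ≡ (Sh T ∧ˢ Sh T′))
proposition38 m n = Sh-surjective , Sh-meet , λ _∧ᵖ_ _∧ˢ_ isMeetᵖ isMeetˢ T T′ →
  -- The shadow of the meet and the meet of the shadows are both greatest lower bounds of the same
  -- pair.
  IsMeet-unique (IsMeetSemilattice.antisym isMeetˢ)
    (Sh-meet T T′ (T ∧ᵖ T′) (IsMeetSemilattice.infimum isMeetᵖ T T′))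
    (IsMeetSemilattice.infimum isMeetˢ (Sh T) (Sh T′))
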